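{- Let $G$ be a triangulated planar graph (embedded in the plane, every face a triangle) with vertex set $V(G)=\{v_1,\dots,v_N\}$, and let $G^*$ be its expanded dual graph with intercity edge set $E^*_I$ and Fisher-city edge set $E^*_C$. Let $\mathcal{C}_+=\{+1\}\times\{\pm1\}^{N-1}$ be the set of spin configurations $X=(x_{v_1},\dots,x_{v_N})\in\{\pm1\}^N$ with $x_{v_1}=+1$. Then the map $M$ (defined in the context) restricted to $\mathcal{C}_+$ is a bijection between $\mathcal{C}_+$ and $\mathrm{PM}(G^*)$, the set of perfect matchings of $G^*$.
   Context: Graphs have no loops or multiple edges unless stated. A perfect matching of a graph is a set of pairwise disjoint edges whose union is the whole vertex set. Dual graph: $G_F$ has one vertex per face of $G$, and two faces are adjacent in $G_F$ iff they share an edge of $G$; it is embedded so that each edge of $G_F$ crosses exactly the corresponding shared edge of $G$. Since $G$ is triangulated, every vertex of $G_F$ has degree 3. The expanded dual graph $G^*$ is obtained from $G_F$ by replacing each vertex $f$ of $G_F$ by a triangle $K_3$ (a "Fisher city") such that each of the three triangle vertices is incident to exactly one of the three edges of $G_F$ formerly incident to $f$. The edges of $G^*$ coming from edges of $G_F$ are the intercity edges $E^*_I$; the triangle edges form $E^*_C$. Each $e^*\in E^*_I$ crosses exactly one edge of $G$, giving a bijection $g:E^*_I\to E(G)$. For $X\in\{\pm1\}^N$ let $I(X)=\{e^*\in E^*_I : g(e^*)=\{v,w\},\ x_v=x_w\}$. Every Fisher city is incident to an odd number of edges of $I(X)$, so $I(X)$ can be completed in a unique way, by adding edges from $E^*_C$,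 to a perfect matching of $G^*$; this perfect matching is denoted $M(X)$. -}

module Defs where

open import Data.Nat using (ℕ; zero; suc; _+_; _*_)
open import Data.Fin using (Fin; zero; suc)
import Data.Fin as Fin
open import Data.Fin.Properties using () renaming (_≟_ to _≟F_)
open import Data.Product using (Σ; ∃; _×_; _,_; proj₁; proj₂)
open import Data.Product.Properties using (≡-dec)
open import Data.Sum using (_⊎_)
open import Data.Bool using (Bool; true; false; _∧_; _∨_; not)
open import Data.Sign using (Sign)
import Data.Sign as Sign
open import Function using (_∘_)
open import Function.Definitions using (Injective)
open import Relation.Nullary using (¬_; Dec; yes; no)
open import Relation.Nullary.Decidable using (⌊_⌋)
open import Relation.Binary.PropositionalEquality using (_≡_; _≢_)
open import Relation.Binary.Construct.Closure.ReflexiveTransitive using (Star)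

-- cyclic successor / predecessor on the three corners of a triangle
next3 : Fin 3 → Fin 3
next3 zero = suc zero
next3 (suc zero) = suc (suc zero)
next3 (suc (suc zero)) = zero

prev3 : Fin 3 → Fin 3
prev3 zero = suc (suc zero)
prev3 (suc zero) = zero
prev3 (suc (suc zero)) = suc zero

iterate : {A : Set} → (A → A) → ℕ → A → A
iterate f zero a = a
iterate f (suc k) a = f (iterate f k a)

-- A triangulated planar graph with vertex set Fin N, given combinatorially
-- as an oriented triangulation of the sphere.
--  * faces are Fin F; face f has corners corner f 0, corner f 1, corner f 2
--    (in the cyclic order induced by a fixed orientation of the sphere);
--  * a dart (f , i) is the side of face f going from corner f i to corner f (i+1);
--  * opp glues each side to the oppositely oriented side of the adjacent face.
record Triangulation (N : ℕ) : Set where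
  field
    F      : ℕ
    corner : Fin F → Fin 3 → Fin N
    opp    : Fin F × Fin 3 → Fin F × Fin 3

  Dart : Set
  Dart = Fin F × Fin 3

  src : Dart → Fin N
  src (f , i) = corner f i

  tgt : Dart → Fin N
  tgt (f , i) = corner f (next3 i)

  -- rotation of darts around their common source vertex
  rot : Dart → Dart
  rot (f , i) = opp (f , prev3 i)

  -- adjacency in G: {u , v} is an edge iff it is a side of some face
  Adj : Fin N → Fin N → Set
  Adj u v = Σ Dart λ d → src d ≡ u × tgt d ≡ v

  field
    -- each face is a triangle on three distinct vertices (no loops)
    corner-inj : ∀ f → Injective _≡_ _≡_ (corner f)
    -- sides are glued in pairs, with opposite orientation
    opp-invol  : ∀ d → opp (opp d) ≡ d
    opp-nofix  : ∀ d → opp d ≢ d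
    opp-src    : ∀ d → src (opp d) ≡ tgt d
    opp-tgt    : ∀ d → tgt (opp d) ≡ src d
    -- no multiple edges: a directed edge is the side of at most one face
    simple     : ∀ d e → src d ≡ src e → tgt d ≡ tgt e → d ≡ e
    -- every vertex lies on some face
    covered    : ∀ v → Σ Dart λ d → src d ≡ v
    -- the faces around each vertex form a single disk (surface condition)
    vertex-disk : ∀ d e → src d ≡ src e → ∃ λ k → iterate rot k d ≡ e
    -- G is connected
    connected  : ∀ u v → Star Adj u v
    -- Euler characteristic 2 (sphere): N - E + F = 2 with 2E = 3F
    euler      : 2 * N + 2 * F ≡ 3 * F + 4

module _ {N : ℕ} (T : Triangulation N) where
  open Triangulation T

  _≟D_ : (d e : Dart) → Dec (d ≡ e)
  _≟D_ = ≡-dec _≟F_ _≟F_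

  -- Expanded dual graph G*: vertex set Dart (Fisher city of face f = {(f,i)}).
  -- Intercity edges {d , opp d} (crossing the edge {src d , tgt d} of G);
  -- city edges {(f,i) , (f,j)} with i ≠ j.
  AdjStar : Dart → Dart → Set
  AdjStar u v = (v ≡ opp u) ⊎ (proj₁ u ≡ proj₁ v × proj₂ u ≢ proj₂ v)

  -- a set of edges of G* is given by a symmetric Bool-valued relation
  -- supported on adjacent pairs
  EdgeSet : Set
  EdgeSet = Dart → Dart → Bool

  record IsPerfectMatching (S : EdgeSet) : Set where
    field
      edges    : ∀ u v → S u v ≡ true → AdjStar u v
      sym      : ∀ u v → S u v ≡ S v u
      disjoint : ∀ u v w → S u v ≡ true → S u w ≡ true → v ≡ w
      covering : ∀ u → Σ Dart λ v → S u v ≡ true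

  -- spins agree along the edge of G crossed by the intercity edge at d
  agree : (Fin N → Sign) → Dart → Bool
  agree X d = ⌊ X (src d) Sign.≟ X (tgt d) ⌋

  -- I(X): intercity edges whose crossed edge has equal spins
  I : (Fin N → Sign) → EdgeSet
  I X u v = ⌊ v ≟D opp u ⌋ ∧ agree X u

  -- M(X): I(X) completed by the city edges joining vertices not covered by I(X)
  M : (Fin N → Sign) → EdgeSet
  M X u v = I X u v ∨
            (⌊ proj₁ u ≟F proj₁ v ⌋ ∧ not ⌊ proj₂ u ≟F proj₂ v ⌋
             ∧ not (agree X u) ∧ not (agree X v))

-- M(X) is a perfect matching because around each Fisher city the number of sides whose endpoints
-- agree is odd: either all three city vertices are matched across, or exactly one is and the other
-- two are joined inside the city.  M(X) records the agreement pattern of X on every edge of G, which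
-- determines X along paths of the connected graph G once x_{v_1} = +1.  Conversely a perfect matching
-- is determined by its intercity edges, whose pattern a is odd at every face, so it suffices to realise
-- every such pattern as an agreement pattern.  Grow a spanning tree of G, choosing spins along it to
-- meet a on tree edges while keeping the faces connected across the remaining edges (the faces around
-- a vertex form a disk), then grow a spanning tree of that dual graph.  By Euler's formula the two
-- trees use every edge; the discrepancy between a and the agreement pattern vanishes on the first
-- tree and has even parity at each face, so peeling the dual tree from its leaves it vanishes everywhere.

module Submission where

open import Defs
open import Data.Nat using (ℕ; zero; suc; _+_; _*_; _≤_; _<_; z≤n; s≤s; s≤s⁻¹)
open import Data.Nat.Properties
open import Data.Fin using (Fin; zero; suc)
open import Data.Fin.Properties using (*↔×) renaming (_≟_ to _≟F_)
import Data.Fin.Properties as Finₚ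
open import Data.Product using (Σ; ∃; _×_; _,_; proj₁; proj₂)
open import Data.Sum using (_⊎_; inj₁; inj₂)
open import Data.Bool using (Bool; true; false; _∧_; _∨_; not; _xor_; if_then_else_)
open import Data.Bool.Properties
  using (∨-zeroʳ; ∨-identityʳ; xor-comm; xor-assoc; xor-same; xor-identityʳ; xor-∧-commutativeRing)
open import Data.Empty using (⊥; ⊥-elim)
open import Data.Sign using (Sign)
import Data.Sign as Sign
open import Function using (_∘_; _↔_; Inverse)
open import Function.Construct.Identity using (↔-id)
open import Relation.Nullary using (¬_; Dec; yes; no; contradiction)
open import Relation.Nullary.Decidable using (⌊_⌋)
open import Relation.Binary.Definitions using (DecidableEquality; tri<; tri≈; tri>)
open import Relation.Binary.PropositionalEquality
open import Relation.Binary.Construct.Closure.ReflexiveTransitive using (Star; ε; _◅_; _◅◅_; _⋆; reverse)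
open import Algebra.Bundles using (CommutativeRing)
open import Data.Nat.Tactic.RingSolver using (solve-∀)
open import Data.Vec.Functional using (updateAt)
open import Data.Vec.Functional.Properties using (updateAt-updates; updateAt-minimal)

private
  variable
    A B : Set

-- Booleans and decisions

true≢false : true ≢ false
true≢false ()

∨-true⇒ : ∀ {x y} → x ∨ y ≡ true → x ≡ true ⊎ y ≡ true
∨-true⇒ {true} _ = inj₁ refl
∨-true⇒ {false} e = inj₂ e

∧-true⇒ : ∀ {x y} → x ∧ y ≡ true → x ≡ true × y ≡ true
∧-true⇒ {true} e = refl , e

not-true⇒ : ∀ {x} → not x ≡ true → x ≡ false
not-true⇒ {false} _ = refl

xor≡false⇒≡ : ∀ {x y} → x xor y ≡ false → x ≡ y
xor≡false⇒≡ {true} {true} _ = refl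
xor≡false⇒≡ {false} {false} _ = refl

bool-ext : ∀ {x y : Bool} → (x ≡ true → y ≡ true) → (y ≡ true → x ≡ true) → x ≡ y
bool-ext {true} x⇒y _ = sym (x⇒y refl)
bool-ext {false} {true} _ y⇒x = y⇒x refl
bool-ext {false} {false} _ _ = refl

⌊⌋-true : (a? : Dec A) → A → ⌊ a? ⌋ ≡ true
⌊⌋-true (yes _) _ = refl
⌊⌋-true (no ¬a) a = contradiction a ¬a

⌊⌋-false : (a? : Dec A) → ¬ A → ⌊ a? ⌋ ≡ false
⌊⌋-false (yes a) ¬a = contradiction a ¬a
⌊⌋-false (no _) _ = refl

⌊⌋-true⁻¹ : (a? : Dec A) → ⌊ a? ⌋ ≡ true → A
⌊⌋-true⁻¹ (yes a) _ = a

⌊⌋-false⁻¹ : (a? : Dec A) → ⌊ a? ⌋ ≡ false → ¬ A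
⌊⌋-false⁻¹ (no ¬a) _ = ¬a

⌊⌋-cong : (a? : Dec A) (b? : Dec B) → (A → B) → (B → A) → ⌊ a? ⌋ ≡ ⌊ b? ⌋
⌊⌋-cong (yes a) b? f g = sym (⌊⌋-true b? (f a))
⌊⌋-cong (no ¬a) b? f g = sym (⌊⌋-false b? (¬a ∘ g))


-- The cyclic order on the corners of a triangle

next3≢ : ∀ i → next3 i ≢ i
next3≢ zero ()
next3≢ (suc zero) ()
next3≢ (suc (suc zero)) ()

prev3≢ : ∀ i → prev3 i ≢ i
prev3≢ zero ()
prev3≢ (suc zero) ()
prev3≢ (suc (suc zero)) ()

next3≢prev3 : ∀ i → next3 i ≢ prev3 i
next3≢prev3 zero ()
next3≢prev3 (suc zero) ()
next3≢prev3 (suc (suc zero)) ()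

next3-prev3 : ∀ i → next3 (prev3 i) ≡ i
next3-prev3 zero = refl
next3-prev3 (suc zero) = refl
next3-prev3 (suc (suc zero)) = refl

prev3-prev3 : ∀ i → prev3 (prev3 i) ≡ next3 i
prev3-prev3 zero = refl
prev3-prev3 (suc zero) = refl
prev3-prev3 (suc (suc zero)) = refl

next3-next3≢ : ∀ i → next3 (next3 i) ≢ i
next3-next3≢ zero ()
next3-next3≢ (suc zero) ()
next3-next3≢ (suc (suc zero)) ()

≢⇒next3⊎prev3 : ∀ {i j} → j ≢ i → j ≡ next3 i ⊎ j ≡ prev3 i
≢⇒next3⊎prev3 {zero} {zero} j≢i = contradiction refl j≢i
≢⇒next3⊎prev3 {zero} {suc zero} _ = inj₁ refl
≢⇒next3⊎prev3 {zero} {suc (suc zero)} _ = inj₂ refl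
≢⇒next3⊎prev3 {suc zero} {zero} _ = inj₂ refl
≢⇒next3⊎prev3 {suc zero} {suc zero} j≢i = contradiction refl j≢i
≢⇒next3⊎prev3 {suc zero} {suc (suc zero)} _ = inj₁ refl
≢⇒next3⊎prev3 {suc (suc zero)} {zero} _ = inj₁ refl
≢⇒next3⊎prev3 {suc (suc zero)} {suc zero} _ = inj₂ refl
≢⇒next3⊎prev3 {suc (suc zero)} {suc (suc zero)} j≢i = contradiction refl j≢i

-- Parity of a triple of booleans

parity : (Fin 3 → Bool) → Bool
parity g = g zero xor g (suc zero) xor g (suc (suc zero))

xor-rotate : ∀ a b c → a xor b xor c ≡ b xor c xor a
xor-rotate a b c = trans (xor-comm a (b xor c)) (xor-assoc b c a)

parity-at : ∀ g i → parity g ≡ g i xor g (next3 i) xor g (prev3 i)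
parity-at g zero = refl
parity-at g (suc zero) = xor-rotate (g zero) (g (suc zero)) (g (suc (suc zero)))
parity-at g (suc (suc zero)) = sym (xor-rotate (g (suc (suc zero))) (g zero) (g (suc zero)))

parity-xor : ∀ g h → parity (λ i → g i xor h i) ≡ parity g xor parity h
parity-xor g h = begin
  (g₀ xor h₀) xor ((g₁ xor h₁) xor (g₂ xor h₂)) ≡⟨ cong ((g₀ xor h₀) xor_) (interchange g₁ h₁ g₂ h₂) ⟩
  (g₀ xor h₀) xor ((g₁ xor g₂) xor (h₁ xor h₂)) ≡⟨ interchange g₀ h₀ _ _ ⟩
  parity g xor parity h ∎
  where
  open ≡-Reasoning
  open import Algebra.Properties.CommutativeSemigroup
    (CommutativeRing.+-commutativeSemigroup xor-∧-commutativeRing) using (interchange)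
  g₀ = g zero
  g₁ = g (suc zero)
  g₂ = g (suc (suc zero))
  h₀ = h zero
  h₁ = h (suc zero)
  h₂ = h (suc (suc zero))

odd⇒mate-false : ∀ g i → parity g ≡ true → g i ≡ false → g (next3 i) ≡ false ⊎ g (prev3 i) ≡ false
odd⇒mate-false g i odd gᵢ = xor-true (g (next3 i)) (g (prev3 i)) (begin
  g (next3 i) xor g (prev3 i)                   ≡⟨ cong (λ b → b xor g (next3 i) xor g (prev3 i)) gᵢ ⟨
  g i xor g (next3 i) xor g (prev3 i)           ≡⟨ parity-at g i ⟨
  parity g                                      ≡⟨ odd ⟩
  true                                          ∎)
  where
  open ≡-Reasoning
  xor-true : ∀ x y → x xor y ≡ true → x ≡ false ⊎ y ≡ false
  xor-true false y _ = inj₁ refl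
  xor-true true false _ = inj₂ refl

false-xor₃ : ∀ {x y z} → x ≡ false → y ≡ false → z ≡ false → x xor y xor z ≡ false
false-xor₃ refl refl refl = refl

odd⇒¬all-false : ∀ g i → parity g ≡ true →
  g i ≡ false → g (next3 i) ≡ false → g (prev3 i) ≡ false → ⊥
odd⇒¬all-false g i odd gᵢ gₙ gₚ with () ← trans (sym odd) (trans (parity-at g i) (false-xor₃ gᵢ gₙ gₚ))

even⇒false : ∀ g i → parity g ≡ false → g (next3 i) ≡ false → g (prev3 i) ≡ false → g i ≡ false
even⇒false g i even gₙ gₚ = begin
  g i                                  ≡⟨ xor-identityʳ (g i) ⟨
  g i xor false xor false              ≡⟨ cong₂ (λ y z → g i xor y xor z) gₙ gₚ ⟨
  g i xor g (next3 i) xor g (prev3 i)  ≡⟨ parity-at g i ⟨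
  parity g                             ≡⟨ even ⟩
  false                                ∎
  where open ≡-Reasoning

odd⇒false-mates-unique : ∀ {g i j k} → parity g ≡ true → g i ≡ false → g j ≡ false → g k ≡ false →
  j ≢ i → k ≢ i → j ≡ k
odd⇒false-mates-unique {g} {i} {j} {k} odd gᵢ gⱼ gₖ j≢i k≢i with ≢⇒next3⊎prev3 j≢i | ≢⇒next3⊎prev3 k≢i
... | inj₁ j≡n | inj₁ k≡n = trans j≡n (sym k≡n)
... | inj₂ j≡p | inj₂ k≡p = trans j≡p (sym k≡p)
... | inj₁ refl | inj₂ refl = ⊥-elim (odd⇒¬all-false g i odd gᵢ gⱼ gₖ)
... | inj₂ refl | inj₁ refl = ⊥-elim (odd⇒¬all-false g i odd gᵢ gₖ gⱼ)

-- Signs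

agree-triangle : ∀ (s t r : Sign) → ⌊ s Sign.≟ t ⌋ xor ⌊ t Sign.≟ r ⌋ xor ⌊ r Sign.≟ s ⌋ ≡ true
agree-triangle Sign.+ Sign.+ Sign.+ = refl
agree-triangle Sign.+ Sign.+ Sign.- = refl
agree-triangle Sign.+ Sign.- Sign.+ = refl
agree-triangle Sign.+ Sign.- Sign.- = refl
agree-triangle Sign.- Sign.+ Sign.+ = refl
agree-triangle Sign.- Sign.+ Sign.- = refl
agree-triangle Sign.- Sign.- Sign.+ = refl
agree-triangle Sign.- Sign.- Sign.- = refl

agree-transport : ∀ {s t s′ t′ : Sign} → s ≡ s′ → ⌊ s Sign.≟ t ⌋ ≡ ⌊ s′ Sign.≟ t′ ⌋ → t ≡ t′
agree-transport {Sign.+} {Sign.+} {t′ = Sign.+} refl _ = refl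
agree-transport {Sign.+} {Sign.-} {t′ = Sign.-} refl _ = refl
agree-transport {Sign.-} {Sign.+} {t′ = Sign.+} refl _ = refl
agree-transport {Sign.-} {Sign.-} {t′ = Sign.-} refl _ = refl

signAgreeing : Bool → Sign → Sign
signAgreeing true s = s
signAgreeing false s = Sign.opposite s

signAgreeing-agrees : ∀ b s → ⌊ s Sign.≟ signAgreeing b s ⌋ ≡ b
signAgreeing-agrees true Sign.+ = refl
signAgreeing-agrees true Sign.- = refl
signAgreeing-agrees false Sign.+ = refl
signAgreeing-agrees false Sign.- = refl

-- Counting

countᶠ : ∀ {m} → (Fin m → Bool) → ℕ
countᶠ {zero} p = 0
countᶠ {suc m} p = (if p zero then 1 else 0) + countᶠ (p ∘ suc)

countᶠ-cong : ∀ {m} {p q : Fin m → Bool} → (∀ i → p i ≡ q i) → countᶠ p ≡ countᶠ q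
countᶠ-cong {zero} _ = refl
countᶠ-cong {suc m} p≗q = cong₂ _+_ (cong (λ b → if b then 1 else 0) (p≗q zero)) (countᶠ-cong (p≗q ∘ suc))

countᶠ-none : ∀ {m} → countᶠ {m} (λ _ → false) ≡ 0
countᶠ-none {zero} = refl
countᶠ-none {suc m} = countᶠ-none {m}

countᶠ-≤ : ∀ {m} (p : Fin m → Bool) → countᶠ p ≤ m
countᶠ-≤ {zero} p = z≤n
countᶠ-≤ {suc m} p with p zero
... | true = s≤s (countᶠ-≤ (p ∘ suc))
... | false = m≤n⇒m≤1+n (countᶠ-≤ (p ∘ suc))

countᶠ-∨ : ∀ {m} (p q : Fin m → Bool) → (∀ i → p i ≡ true → q i ≡ false) →
  countᶠ (λ i → p i ∨ q i) ≡ countᶠ p + countᶠ q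
countᶠ-∨ {zero} p q _ = refl
countᶠ-∨ {suc m} p q disj with p zero in p₀ | q zero in q₀
... | true | true = contradiction (trans (sym q₀) (disj zero p₀)) true≢false
... | true | false = cong suc (countᶠ-∨ (p ∘ suc) (q ∘ suc) (disj ∘ suc))
... | false | true = trans (cong suc (countᶠ-∨ (p ∘ suc) (q ∘ suc) (disj ∘ suc))) (sym (+-suc _ _))
... | false | false = countᶠ-∨ (p ∘ suc) (q ∘ suc) (disj ∘ suc)

countᶠ-single : ∀ {m} (j : Fin m) → countᶠ (λ i → ⌊ i ≟F j ⌋) ≡ 1
countᶠ-single {suc m} zero = cong suc (trans (countᶠ-cong {m} (λ i → ⌊⌋-false (suc i ≟F zero) λ ())) (countᶠ-none {m}))
countᶠ-single {suc m} (suc j) =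
  trans (countᶠ-cong (λ i → ⌊⌋-cong (suc i ≟F suc j) (i ≟F j) Finₚ.suc-injective (cong suc))) (countᶠ-single j)

countᶠ≡⇒all : ∀ {m} (p : Fin m → Bool) → countᶠ p ≡ m → ∀ i → p i ≡ true
countᶠ≡⇒all {suc m} p full i with p zero in p₀
countᶠ≡⇒all {suc m} p full zero | true = p₀
countᶠ≡⇒all {suc m} p full (suc i) | true = countᶠ≡⇒all (p ∘ suc) (suc-injective full) i
... | false = contradiction (subst (_≤ m) full (countᶠ-≤ (p ∘ suc))) 1+n≰n

countᶠ<⇒∃false : ∀ {m} (p : Fin m → Bool) → countᶠ p < m → ∃ λ i → p i ≡ false
countᶠ<⇒∃false {suc m} p lt with p zero in p₀
... | false = zero , p₀
... | true with countᶠ<⇒∃false (p ∘ suc) (s≤s⁻¹ lt)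
...   | i , pᵢ = suc i , pᵢ

module Counting {A : Set} {size : ℕ} (enum : Fin size ↔ A) (_≟_ : DecidableEquality A) where
  open Inverse enum using (to; from; strictlyInverseˡ; strictlyInverseʳ)

  count : (A → Bool) → ℕ
  count p = countᶠ (p ∘ to)

  count-none : count (λ _ → false) ≡ 0
  count-none = countᶠ-none {size}

  count-∨ : ∀ p q → (∀ x → p x ≡ true → q x ≡ false) → count (λ x → p x ∨ q x) ≡ count p + count q
  count-∨ p q disj = countᶠ-∨ (p ∘ to) (q ∘ to) (disj ∘ to)

  count-single : ∀ x → count (λ y → ⌊ y ≟ x ⌋) ≡ 1
  count-single x = trans (countᶠ-cong λ i → ⌊⌋-cong (to i ≟ x) (i ≟F from x) to≡ from≡) (countᶠ-single (from x))
    where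
    to≡ : ∀ {i} → to i ≡ x → i ≡ from x
    to≡ {i} refl = sym (strictlyInverseʳ i)
    from≡ : ∀ {i} → i ≡ from x → to i ≡ x
    from≡ refl = strictlyInverseˡ x

  count≡size⇒all : ∀ p → count p ≡ size → ∀ x → p x ≡ true
  count≡size⇒all p full x = subst (λ y → p y ≡ true) (strictlyInverseˡ x) (countᶠ≡⇒all (p ∘ to) full (from x))

  count<size⇒∃false : ∀ p → count p < size → ∃ λ x → p x ≡ false
  count<size⇒∃false p lt with countᶠ<⇒∃false (p ∘ to) lt
  ... | i , pᵢ = to i , pᵢ

  insert : (A → Bool) → A → A → Bool
  insert p x y = p y ∨ ⌊ y ≟ x ⌋

  count-insert : ∀ p x → p x ≡ false → count (insert p x) ≡ suc (count p)
  count-insert p x pₓ = begin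
    count (insert p x)                 ≡⟨ count-∨ p (λ y → ⌊ y ≟ x ⌋) (λ y pᵧ → ⌊⌋-false (y ≟ x) (y≢x pᵧ)) ⟩
    count p + count (λ y → ⌊ y ≟ x ⌋)   ≡⟨ cong (count p +_) (count-single x) ⟩
    count p + 1                        ≡⟨ +-comm (count p) 1 ⟩
    suc (count p)                      ∎
    where
    open ≡-Reasoning
    y≢x : ∀ {y} → p y ≡ true → y ≢ x
    y≢x pᵧ refl = true≢false (trans (sym pᵧ) pₓ)

  insert-new : ∀ p x → insert p x x ≡ true
  insert-new p x = trans (cong (p x ∨_) (⌊⌋-true (x ≟ x) refl)) (∨-zeroʳ (p x))

  insert-old : ∀ p x {y} → p y ≡ true → insert p x y ≡ true
  insert-old p x pᵧ = cong (_∨ _) pᵧ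

  insert-other : ∀ p x {y} → y ≢ x → insert p x y ≡ p y
  insert-other p x {y} y≢x = trans (cong (p y ∨_) (⌊⌋-false (y ≟ x) y≢x)) (∨-identityʳ (p y))

  insert-cases : ∀ p x {y} → insert p x y ≡ true → p y ≡ true ⊎ y ≡ x
  insert-cases p x {y} e with y ≟ x
  ... | yes y≡x = inj₂ y≡x
  ... | no _ = inj₁ (trans (sym (∨-identityʳ (p y))) e)

Star-leaves : ∀ {R : A → A → Set} (P : A → Bool) {i j} → P i ≡ true → P j ≡ false → Star R i j →
  ∃ λ u → ∃ λ v → R u v × P u ≡ true × P v ≡ false
Star-leaves P Pᵢ Pⱼ ε = contradiction (trans (sym Pᵢ) Pⱼ) true≢false
Star-leaves P {i} Pᵢ Pⱼ (_◅_ {j = k} r rs) with P k in Pₖ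
... | true = Star-leaves P Pₖ Pⱼ rs
... | false = i , k , r , Pᵢ , Pₖ

module ExpandedDual {N : ℕ} (T : Triangulation N) where
  open Triangulation T

  face : Dart → Fin F
  face = proj₁

  _≟ᴰ_ : DecidableEquality Dart
  _≟ᴰ_ = _≟D_ T

  into : Dart → Dart
  into (f , i) = f , prev3 i

  opp-face≢ : ∀ d → face (opp d) ≢ face d
  opp-face≢ (f , i) eq with opp (f , i) | opp-src (f , i) | opp-tgt (f , i)
  ... | g , j | src≡ | tgt≡ with eq
  ... | refl = next3-next3≢ i (trans (cong next3 (sym j≡)) (corner-inj f tgt≡))
    where
    j≡ : j ≡ next3 i
    j≡ = corner-inj f src≡

  agree-opp : ∀ X d → agree T X (opp d) ≡ agree T X d
  agree-opp X d = ⌊⌋-cong (X (src (opp d)) Sign.≟ X (tgt (opp d))) (X (src d) Sign.≟ X (tgt d))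
    (λ eq → trans (cong X (sym (opp-tgt d))) (trans (sym eq) (cong X (opp-src d))))
    (λ eq → trans (cong X (opp-src d)) (trans (sym eq) (cong X (sym (opp-tgt d)))))

  agree-odd : ∀ X f → parity (λ i → agree T X (f , i)) ≡ true
  agree-odd X f = agree-triangle (X (corner f zero)) (X (corner f (suc zero))) (X (corner f (suc (suc zero))))

  tgt-into : ∀ d → tgt (into d) ≡ src d
  tgt-into (f , i) = cong (corner f) (next3-prev3 i)

  src-rot : ∀ d → src (rot d) ≡ src d
  src-rot d = trans (opp-src (into d)) (tgt-into d)

  src-iterate-rot : ∀ k d → src (iterate rot k d) ≡ src d
  src-iterate-rot zero d = refl
  src-iterate-rot (suc k) d = trans (src-rot (iterate rot k d)) (src-iterate-rot k d)

  DualAdjAvoiding : (Dart → Bool) → Fin F → Fin F → Set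
  DualAdjAvoiding E f g = ∃ λ x → face x ≡ f × face (opp x) ≡ g × E x ≡ false

  DualAdjAvoiding-sym : ∀ {E} → (∀ x → E (opp x) ≡ E x) → ∀ {f g} → DualAdjAvoiding E f g → DualAdjAvoiding E g f
  DualAdjAvoiding-sym E-opp (x , x∈f , ox∈g , x∉E) =
    opp x , ox∈g , trans (cong face (opp-invol x)) x∈f , trans (E-opp x) x∉E

  -- Walking around a vertex crosses the sides into that vertex; a loop back to the start may be cut short.
  around : ∀ E z → (∀ y → src y ≡ src z → rot y ≢ z → E (into y) ≡ false) →
    ∀ k → Star (DualAdjAvoiding E) (face z) (face (iterate rot k z))
  around E z avoid zero = ε
  around E z avoid (suc k) with rot (iterate rot k z) ≟ᴰ z
  ... | yes rot≡z = subst (λ y → Star (DualAdjAvoiding E) (face z) (face y)) (sym rot≡z) ε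
  ... | no rot≢z = around E z avoid k ◅◅ (into y , refl , refl , avoid y (src-iterate-rot k z) rot≢z) ◅ ε
    where
    y = iterate rot k z

  faces-around-connected : ∀ E z → (∀ y → src y ≡ src z → rot y ≢ z → E (into y) ≡ false) →
    ∀ e → src z ≡ src e → Star (DualAdjAvoiding E) (face z) (face e)
  faces-around-connected E z avoid e src≡ with vertex-disk z e src≡
  ... | k , rotᵏz≡e = subst (λ y → Star (DualAdjAvoiding E) (face z) (face y)) rotᵏz≡e (around E z avoid k)

  dual-connected : ∀ f g → Star (DualAdjAvoiding (λ _ → false)) f g
  dual-connected f g = along (connected (corner f zero) (corner g zero)) (f , zero) (g , zero) refl refl
    where
    nothing-avoided : ∀ z y → src y ≡ src z → rot y ≢ z → false ≡ false
    nothing-avoided _ _ _ _ = refl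
    along : ∀ {u v} → Star Adj u v → ∀ d e → src d ≡ u → src e ≡ v →
      Star (DualAdjAvoiding (λ _ → false)) (face d) (face e)
    along ε d e d∈u e∈u = faces-around-connected _ d (nothing-avoided d) e (trans d∈u (sym e∈u))
    along ((x , refl , refl) ◅ xs) d e d∈u e∈v =
      faces-around-connected _ d (nothing-avoided d) x d∈u ◅◅
      (x , refl , refl , refl) ◅ along xs (opp x) e (opp-src x) e∈v

  module Darts = Counting (*↔× {F} {3}) _≟ᴰ_
  open Darts public using () renaming (count to countᴰ; insert to insertᴰ)

  addEdge : (Dart → Bool) → Dart → Dart → Bool
  addEdge E d = insertᴰ (insertᴰ E d) (opp d)

  module _ (E : Dart → Bool) (d : Dart) where

    addEdge-count : E d ≡ false → E (opp d) ≡ false → countᴰ (addEdge E d) ≡ suc (suc (countᴰ E))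
    addEdge-count d∉E od∉E = begin
      countᴰ (addEdge E d)             ≡⟨ Darts.count-insert (insertᴰ E d) (opp d)
                                            (trans (Darts.insert-other E d (opp-nofix d)) od∉E) ⟩
      suc (countᴰ (insertᴰ E d))        ≡⟨ cong suc (Darts.count-insert E d d∉E) ⟩
      suc (suc (countᴰ E))             ∎
      where open ≡-Reasoning

    addEdge-cases : ∀ {y} → addEdge E d y ≡ true → E y ≡ true ⊎ y ≡ d ⊎ y ≡ opp d
    addEdge-cases e with Darts.insert-cases (insertᴰ E d) (opp d) e
    ... | inj₂ y≡od = inj₂ (inj₂ y≡od)
    ... | inj₁ e′ with Darts.insert-cases E d e′
    ...   | inj₁ y∈E = inj₁ y∈E
    ...   | inj₂ y≡d = inj₂ (inj₁ y≡d)

    addEdge-old : ∀ {y} → E y ≡ true → addEdge E d y ≡ true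
    addEdge-old y∈E = Darts.insert-old (insertᴰ E d) (opp d) (Darts.insert-old E d y∈E)

    addEdge-d : addEdge E d d ≡ true
    addEdge-d = Darts.insert-old (insertᴰ E d) (opp d) (Darts.insert-new E d)

    addEdge-opp-d : addEdge E d (opp d) ≡ true
    addEdge-opp-d = Darts.insert-new (insertᴰ E d) (opp d)

    addEdge-other : ∀ {y} → y ≢ d → y ≢ opp d → addEdge E d y ≡ E y
    addEdge-other y≢d y≢od = trans (Darts.insert-other (insertᴰ E d) (opp d) y≢od) (Darts.insert-other E d y≢d)

    addEdge-opp : (∀ y → E (opp y) ≡ E y) → ∀ y → addEdge E d (opp y) ≡ addEdge E d y
    addEdge-opp E-opp y = bool-ext (λ e → subst (λ z → addEdge E d z ≡ true) (opp-invol y) (opp-closed e)) opp-closed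
      where
      opp-closed : ∀ {z} → addEdge E d z ≡ true → addEdge E d (opp z) ≡ true
      opp-closed e with addEdge-cases e
      ... | inj₁ z∈E = addEdge-old (trans (E-opp _) z∈E)
      ... | inj₂ (inj₁ refl) = addEdge-opp-d
      ... | inj₂ (inj₂ refl) = subst (λ z → addEdge E d z ≡ true) (sym (opp-invol d)) addEdge-d

  -- Perfect matchings of the expanded dual graph

  slot : Dart → Fin 3
  slot = proj₂

  CityEdge : (Fin N → Sign) → Dart → Dart → Set
  CityEdge X u v = face u ≡ face v × slot u ≢ slot v × agree T X u ≡ false × agree T X v ≡ false

  -- chosen so that M T X u v unfolds to I T X u v ∨ city X u v
  city : (Fin N → Sign) → Dart → Dart → Bool
  city X u v = ⌊ face u ≟F face v ⌋ ∧ not ⌊ slot u ≟F slot v ⌋ ∧ not (agree T X u) ∧ not (agree T X v)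

  M-cases : ∀ X u v → M T X u v ≡ true → (v ≡ opp u × agree T X u ≡ true) ⊎ CityEdge X u v
  M-cases X u v e with ∨-true⇒ e
  ... | inj₁ intercity with ∧-true⇒ intercity
  ...   | v≡ou , au = inj₁ (⌊⌋-true⁻¹ (v ≟ᴰ opp u) v≡ou , au)
  M-cases X u v e | inj₂ inside with ∧-true⇒ inside
  ... | same-face , rest with ∧-true⇒ rest
  ...   | other-slot , rest′ with ∧-true⇒ rest′
  ...     | au , av = inj₂ (⌊⌋-true⁻¹ (face u ≟F face v) same-face ,
                            ⌊⌋-false⁻¹ (slot u ≟F slot v) (not-true⇒ other-slot) , not-true⇒ au , not-true⇒ av)

  M-intercity : ∀ X u → agree T X u ≡ true → M T X u (opp u) ≡ true
  M-intercity X u au = cong (_∨ city X u (opp u)) (cong₂ _∧_ (⌊⌋-true (opp u ≟ᴰ opp u) refl) au)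

  M-city : ∀ X u v → CityEdge X u v → M T X u v ≡ true
  M-city X u v (fu≡fv , iu≢iv , au , av) = trans (cong (I T X u v ∨_) city-true) (∨-zeroʳ (I T X u v))
    where
    city-true : city X u v ≡ true
    city-true = cong₂ _∧_ (⌊⌋-true (face u ≟F face v) fu≡fv)
             (cong₂ _∧_ (cong not (⌊⌋-false (slot u ≟F slot v) iu≢iv)) (cong₂ _∧_ (cong not au) (cong not av)))

  M-opp : ∀ X u → M T X u (opp u) ≡ agree T X u
  M-opp X u = begin
    M T X u (opp u)                     ≡⟨ cong₂ (λ b c → b ∧ agree T X u ∨ c ∧ rest) (⌊⌋-true (opp u ≟ᴰ opp u) refl)
                                            (⌊⌋-false (face u ≟F face (opp u)) (opp-face≢ u ∘ sym)) ⟩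
    agree T X u ∨ false                 ≡⟨ ∨-identityʳ _ ⟩
    agree T X u                         ∎
    where
    open ≡-Reasoning
    rest = not ⌊ slot u ≟F slot (opp u) ⌋ ∧ not (agree T X u) ∧ not (agree T X (opp u))

  in-face : ∀ {v f} → face v ≡ f → v ≡ (f , slot v)
  in-face {v} = cong (_, slot v)

  M-perfect : ∀ X → IsPerfectMatching T (M T X)
  M-perfect X = record
    { edges = edges
    ; sym = λ u v → bool-ext (M-sym u v) (M-sym v u)
    ; disjoint = disjoint
    ; covering = covering
    }
    where
    edges : ∀ u v → M T X u v ≡ true → AdjStar T u v
    edges u v e with M-cases X u v e
    ... | inj₁ (v≡ou , _) = inj₁ v≡ou
    ... | inj₂ (fu≡fv , iu≢iv , _) = inj₂ (fu≡fv , iu≢iv)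

    M-sym : ∀ u v → M T X u v ≡ true → M T X v u ≡ true
    M-sym u v e with M-cases X u v e
    ... | inj₁ (refl , au) = subst (λ w → M T X (opp u) w ≡ true) (opp-invol u)
                               (M-intercity X (opp u) (trans (agree-opp X u) au))
    ... | inj₂ (fu≡fv , iu≢iv , au , av) = M-city X v u (sym fu≡fv , iu≢iv ∘ sym , av , au)

    disjoint : ∀ u v w → M T X u v ≡ true → M T X u w ≡ true → v ≡ w
    disjoint u v w e e′ with M-cases X u v e | M-cases X u w e′
    ... | inj₁ (v≡ou , _) | inj₁ (w≡ou , _) = trans v≡ou (sym w≡ou)
    ... | inj₁ (_ , au) | inj₂ (_ , _ , au′ , _) = contradiction (trans (sym au) au′) true≢false
    ... | inj₂ (_ , _ , au , _) | inj₁ (_ , au′) = contradiction (trans (sym au′) au) true≢false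
    ... | inj₂ (fu≡fv , iu≢iv , au , av) | inj₂ (fu≡fw , iu≢iw , _ , aw) =
      trans (in-face (sym fu≡fv)) (trans (cong (face u ,_) iv≡iw) (sym (in-face (sym fu≡fw))))
      where
      iv≡iw : slot v ≡ slot w
      iv≡iw = odd⇒false-mates-unique (agree-odd X (face u)) au
                (subst (λ x → agree T X x ≡ false) (in-face (sym fu≡fv)) av)
                (subst (λ x → agree T X x ≡ false) (in-face (sym fu≡fw)) aw)
                (iu≢iv ∘ sym) (iu≢iw ∘ sym)

    covering : ∀ u → ∃ λ v → M T X u v ≡ true
    covering u = cover (agree T X u) refl
      where
      cover : ∀ b → agree T X u ≡ b → ∃ λ v → M T X u v ≡ true
      cover true au = opp u , M-intercity X u au
      cover false au with odd⇒mate-false (λ i → agree T X (face u , i)) (slot u) (agree-odd X (face u)) au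
      ... | inj₁ an = (face u , next3 (slot u)) , M-city X u _ (refl , next3≢ (slot u) ∘ sym , au , an)
      ... | inj₂ ap = (face u , prev3 (slot u)) , M-city X u _ (refl , prev3≢ (slot u) ∘ sym , au , ap)

  M-injective : ∀ X Y v₀ → X v₀ ≡ Y v₀ → (∀ u v → M T X u v ≡ M T Y u v) → ∀ w → X w ≡ Y w
  M-injective X Y v₀ X≡Y M≡M w = along (connected v₀ w) X≡Y
    where
    same-agree : ∀ d → agree T X d ≡ agree T Y d
    same-agree d = trans (sym (M-opp X d)) (trans (M≡M d (opp d)) (M-opp Y d))
    along : ∀ {u v} → Star Adj u v → X u ≡ Y u → X v ≡ Y v
    along ε X≡Y = X≡Y
    along ((d , refl , refl) ◅ ds) X≡Y = along ds (agree-transport X≡Y (same-agree d))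

  module PerfectMatching {S : EdgeSet T} (pm : IsPerfectMatching T S) where
    open IsPerfectMatching pm renaming (sym to S-sym)

    S-sym⇒ : ∀ {u v} → S u v ≡ true → S v u ≡ true
    S-sym⇒ {u} {v} e = trans (S-sym v u) e

    across : Dart → Bool
    across d = S d (opp d)

    across-opp : ∀ d → across (opp d) ≡ across d
    across-opp d = trans (cong (S (opp d)) (opp-invol d)) (S-sym (opp d) d)

    city⇒¬across : ∀ {u v} → S u v ≡ true → face u ≡ face v → across u ≡ false
    city⇒¬across {u} {v} e fu≡fv with across u in a
    ... | false = refl
    ... | true = contradiction (trans (cong face (disjoint u (opp u) v a e)) (sym fu≡fv)) (opp-face≢ u)

    partner : ∀ {u} → across u ≡ false → ∃ λ j → j ≢ slot u × S u (face u , j) ≡ true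
    partner {u} a with covering u
    ... | w , e with edges u w e
    ...   | inj₁ refl = contradiction (trans (sym e) a) true≢false
    ...   | inj₂ (fu≡fw , iu≢iw) = slot w , iu≢iw ∘ sym , subst (λ x → S u x ≡ true) (in-face (sym fu≡fw)) e

    lonely : ∀ f i → across (f , i) ≡ false → across (f , next3 i) ≡ true → across (f , prev3 i) ≡ true → ⊥
    lonely f i a aₙ aₚ with partner a
    ... | j , j≢i , e with ≢⇒next3⊎prev3 j≢i
    ...   | inj₁ refl = contradiction (trans (sym aₙ) (city⇒¬across (S-sym⇒ e) refl)) true≢false
    ...   | inj₂ refl = contradiction (trans (sym aₚ) (city⇒¬across (S-sym⇒ e) refl)) true≢false

    no-matched-cycle : ∀ f → (∀ i → across (f , i) ≡ false) → ∀ i → S (f , i) (f , next3 i) ≡ true → ⊥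
    no-matched-cycle f none i eₙ with partner (none (prev3 i))
    ... | l , l≢p , eₚ with ≢⇒next3⊎prev3 l≢p
    ...   | inj₁ l≡np with refl ← trans l≡np (next3-prev3 i) =
      next3≢prev3 i (cong slot (disjoint (f , i) _ _ eₙ (S-sym⇒ eₚ)))
    ...   | inj₂ l≡pp with refl ← trans l≡pp (prev3-prev3 i) =
      prev3≢ i (cong slot (disjoint (f , next3 i) _ _ (S-sym⇒ eₚ) (S-sym⇒ eₙ)))

    no-triangle : ∀ f → (∀ i → across (f , i) ≡ false) → ⊥
    no-triangle f none with partner (none zero)
    ... | j , j≢0 , e with ≢⇒next3⊎prev3 j≢0
    ...   | inj₁ refl = no-matched-cycle f none zero e
    ...   | inj₂ refl = no-matched-cycle f none (suc (suc zero)) (S-sym⇒ e)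

    across-odd : ∀ f → parity (λ i → across (f , i)) ≡ true
    across-odd f with across (f , zero) in a₀ | across (f , suc zero) in a₁ | across (f , suc (suc zero)) in a₂
    ... | true  | true  | true  = refl
    ... | true  | false | false = refl
    ... | false | true  | false = refl
    ... | false | false | true  = refl
    ... | false | true  | true  = ⊥-elim (lonely f zero a₀ a₁ a₂)
    ... | true  | false | true  = ⊥-elim (lonely f (suc zero) a₁ a₂ a₀)
    ... | true  | true  | false = ⊥-elim (lonely f (suc (suc zero)) a₂ a₀ a₁)
    ... | false | false | false = ⊥-elim (no-triangle f λ { zero → a₀ ; (suc zero) → a₁ ; (suc (suc zero)) → a₂ })

  matching-determined-by-intercity : ∀ {S S′} (pm : IsPerfectMatching T S) (pm′ : IsPerfectMatching T S′) →
    (∀ u → S u (opp u) ≡ S′ u (opp u)) → ∀ u v → S u v ≡ true → S′ u v ≡ true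
  matching-determined-by-intercity {S} {S′} pm pm′ same-across u v e with IsPerfectMatching.edges pm u v e
  ... | inj₁ refl = trans (sym (same-across u)) e
  ... | inj₂ (fu≡fv , iu≢iv) = city-edge
    where
    open PerfectMatching pm
    module PM′ = PerfectMatching pm′

    city-edge : S′ u v ≡ true
    city-edge with PM′.partner (trans (sym (same-across u)) (city⇒¬across e fu≡fv))
    ... | j , j≢iu , e′ =
      subst (λ x → S′ u x ≡ true) (trans (cong (face u ,_) (sym iv≡j)) (sym (in-face (sym fu≡fv)))) e′
      where
      iv≡j : slot v ≡ j
      iv≡j = odd⇒false-mates-unique (across-odd (face u)) (city⇒¬across e fu≡fv)
        (subst (λ x → across x ≡ false) (in-face (sym fu≡fv)) (city⇒¬across (S-sym⇒ e) (sym fu≡fv)))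
        (trans (same-across _) (PM′.city⇒¬across (PM′.S-sym⇒ e′) refl))
        (iu≢iv ∘ sym) j≢iu

-- With n + 1 vertices and m + 1 faces, Euler's formula says that a spanning tree (n edges) and a
-- spanning tree of the dual (m edges) together account for all 3(m + 1) sides of faces.
euler-edges : ∀ n m → 2 * suc n + 2 * suc m ≡ 3 * suc m + 4 → n * 2 + m * 2 ≡ suc m * 3
euler-edges n m euler = +-cancelʳ-≡ 4 _ _ (trans (lhs n m) (trans euler (rhs m)))
  where
  lhs : ∀ n m → n * 2 + m * 2 + 4 ≡ 2 * suc n + 2 * suc m
  lhs = solve-∀
  rhs : ∀ m → 3 * suc m + 4 ≡ suc m * 3 + 4
  rhs = solve-∀

module Realisation {n : ℕ} (T : Triangulation (suc n)) (a : Triangulation.Dart T → Bool)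
                   (a-opp : ∀ d → a (Triangulation.opp T d) ≡ a d)
                   (a-odd : ∀ f → parity (λ i → a (f , i)) ≡ true) where
  open Triangulation T
  open ExpandedDual T

  module Vertices = Counting (↔-id (Fin (suc n))) _≟F_
  module Faces = Counting (↔-id (Fin F)) _≟F_

  record GrowingTree (k : ℕ) : Set where
    field
      reached : Fin (suc n) → Bool
      tree : Dart → Bool
      spin : Fin (suc n) → Sign
      reached-count : Vertices.count reached ≡ suc k
      tree-count : countᴰ tree ≡ k * 2
      root-reached : reached zero ≡ true
      root-spin : spin zero ≡ Sign.+
      tree-reached : ∀ d → tree d ≡ true → reached (src d) ≡ true × reached (tgt d) ≡ true
      tree-opp : ∀ d → tree (opp d) ≡ tree d
      tree-agree : ∀ d → tree d ≡ true → agree T spin d ≡ a d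
      cotree-connected : ∀ f g → Star (DualAdjAvoiding tree) f g

  start : GrowingTree 0
  start = record
    { reached = λ v → ⌊ v ≟F zero ⌋
    ; tree = λ _ → false
    ; spin = λ _ → Sign.+
    ; reached-count = Vertices.count-single zero
    ; tree-count = Darts.count-none
    ; root-reached = refl
    ; root-spin = refl
    ; tree-reached = λ _ ()
    ; tree-opp = λ _ → refl
    ; tree-agree = λ _ ()
    ; cotree-connected = dual-connected
    }

  module Extend {k} (P : GrowingTree k) (d : Dart)
                (u∈ : GrowingTree.reached P (src d) ≡ true) (v∉ : GrowingTree.reached P (tgt d) ≡ false) where
    open GrowingTree P

    u v : Fin (suc n)
    u = src d
    v = tgt d

    reached≢v : ∀ {w} → reached w ≡ true → w ≢ v
    reached≢v w∈ refl = true≢false (trans (sym w∈) v∉)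

    into-v⇒∉tree : ∀ y → tgt y ≡ v → tree y ≡ false
    into-v⇒∉tree y y↦v with tree y in y∈
    ... | false = refl
    ... | true = contradiction y↦v (reached≢v (proj₂ (tree-reached y y∈)))

    d∉tree : tree d ≡ false
    d∉tree = into-v⇒∉tree d refl

    opp-d∉tree : tree (opp d) ≡ false
    opp-d∉tree = trans (tree-opp d) d∉tree

    reached′ : Fin (suc n) → Bool
    reached′ = Vertices.insert reached v

    spin′ : Fin (suc n) → Sign
    spin′ = updateAt spin v (λ _ → signAgreeing (a d) (spin u))

    spin′-reached : ∀ {w} → reached w ≡ true → spin′ w ≡ spin w
    spin′-reached {w} w∈ = updateAt-minimal w v spin (reached≢v w∈)

    tree′ : Dart → Bool
    tree′ = addEdge tree d

    tree′-reached : ∀ y → tree′ y ≡ true → reached′ (src y) ≡ true × reached′ (tgt y) ≡ true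
    tree′-reached y y∈ with addEdge-cases tree d y∈
    ... | inj₁ y∈tree = Vertices.insert-old reached v (proj₁ (tree-reached y y∈tree)) ,
                        Vertices.insert-old reached v (proj₂ (tree-reached y y∈tree))
    ... | inj₂ (inj₁ refl) = Vertices.insert-old reached v u∈ , Vertices.insert-new reached v
    ... | inj₂ (inj₂ refl) = subst (λ w → reached′ w ≡ true) (sym (opp-src d)) (Vertices.insert-new reached v) ,
                             subst (λ w → reached′ w ≡ true) (sym (opp-tgt d)) (Vertices.insert-old reached v u∈)

    agree-d : agree T spin′ d ≡ a d
    agree-d = begin
      ⌊ spin′ u Sign.≟ spin′ v ⌋
        ≡⟨ cong₂ (λ s t → ⌊ s Sign.≟ t ⌋) (spin′-reached u∈) (updateAt-updates v spin) ⟩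
      ⌊ spin u Sign.≟ signAgreeing (a d) (spin u) ⌋
        ≡⟨ signAgreeing-agrees (a d) (spin u) ⟩
      a d
        ∎
      where open ≡-Reasoning

    tree′-agree : ∀ y → tree′ y ≡ true → agree T spin′ y ≡ a y
    tree′-agree y y∈ with addEdge-cases tree d y∈
    ... | inj₁ y∈tree = trans (cong₂ (λ s t → ⌊ s Sign.≟ t ⌋) (spin′-reached (proj₁ (tree-reached y y∈tree)))
                                                              (spin′-reached (proj₂ (tree-reached y y∈tree))))
                              (tree-agree y y∈tree)
    ... | inj₂ (inj₁ refl) = agree-d
    ... | inj₂ (inj₂ refl) = trans (agree-opp spin′ d) (trans agree-d (sym (a-opp d)))

    -- The sides into v other than d are still outside the tree, so the faces around v stay connected.
    around-v : ∀ y → src y ≡ src (opp d) → rot y ≢ opp d → tree′ (into y) ≡ false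
    around-v y y∈v rot≢ = trans (addEdge-other tree d (rot≢ ∘ cong opp) into≢od) (into-v⇒∉tree (into y) into↦v)
      where
      into↦v : tgt (into y) ≡ v
      into↦v = trans (tgt-into y) (trans y∈v (opp-src d))
      into≢od : into y ≢ opp d
      into≢od eq = reached≢v u∈ (trans (sym (opp-tgt d)) (trans (cong tgt (sym eq)) into↦v))

    opp-d⇝d : Star (DualAdjAvoiding tree′) (face (opp d)) (face d)
    opp-d⇝d = faces-around-connected tree′ (opp d) around-v (face d , next3 (slot d)) (opp-src d)

    d⇝opp-d : Star (DualAdjAvoiding tree′) (face d) (face (opp d))
    d⇝opp-d = reverse (DualAdjAvoiding-sym (addEdge-opp tree d tree-opp)) opp-d⇝d

    reconnect : ∀ {f g} → DualAdjAvoiding tree f g → Star (DualAdjAvoiding tree′) f g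
    reconnect (x , x∈f , ox∈g , x∉tree) with x ≟ᴰ d | x ≟ᴰ opp d
    ... | yes refl | _ = subst₂ (Star _) x∈f ox∈g d⇝opp-d
    ... | no _ | yes refl = subst₂ (Star _) x∈f (trans (sym (cong face (opp-invol d))) ox∈g) opp-d⇝d
    ... | no x≢d | no x≢od = (x , x∈f , ox∈g , trans (addEdge-other tree d x≢d x≢od) x∉tree) ◅ ε

    extended : GrowingTree (suc k)
    extended = record
      { reached = reached′
      ; tree = tree′
      ; spin = spin′
      ; reached-count = trans (Vertices.count-insert reached v v∉) (cong suc reached-count)
      ; tree-count = trans (addEdge-count tree d d∉tree opp-d∉tree) (cong (2 +_) tree-count)
      ; root-reached = Vertices.insert-old reached v root-reached
      ; root-spin = trans (spin′-reached root-reached) root-spin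
      ; tree-reached = tree′-reached
      ; tree-opp = addEdge-opp tree d tree-opp
      ; tree-agree = tree′-agree
      ; cotree-connected = λ f g → (reconnect ⋆) (cotree-connected f g)
      }

  module _ {k} (P : GrowingTree k) where
    open GrowingTree P

    extend : k < n → GrowingTree (suc k)
    extend k<n with Vertices.count<size⇒∃false reached (subst (_< suc n) (sym reached-count) (s≤s k<n))
    ... | w , w∉ with Star-leaves reached root-reached w∉ (connected zero w)
    ...   | _ , _ , (d , refl , refl) , u∈ , v∉ = Extend.extended P d u∈ v∉

  grow : ∀ k → k ≤ n → GrowingTree k
  grow zero _ = start
  grow (suc k) k<n = extend (grow k (<⇒≤ k<n)) k<n

  spanning : GrowingTree n
  spanning = grow n ≤-refl

  open GrowingTree spanning using (tree; tree-opp; tree-count; spin; root-spin; tree-agree; cotree-connected)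

  root : Fin F
  root = face (proj₁ (covered zero))

  -- born f is the step at which f was reached, parent f the side of f crossed to reach it
  record GrowingCotree (m : ℕ) : Set where
    field
      reached : Fin F → Bool
      cotree : Dart → Bool
      born : Fin F → ℕ
      parent : Fin F → Dart
      reached-count : Faces.count reached ≡ suc m
      cotree-count : countᴰ cotree ≡ m * 2
      root-reached : reached root ≡ true
      cotree-reached : ∀ x → cotree x ≡ true → reached (face x) ≡ true × reached (face (opp x)) ≡ true
      cotree-opp : ∀ x → cotree (opp x) ≡ cotree x
      cotree-∉tree : ∀ x → cotree x ≡ true → tree x ≡ false
      born-≤ : ∀ f → reached f ≡ true → born f ≤ m
      born-≢ : ∀ x → cotree x ≡ true → born (face x) ≢ born (face (opp x))
      parent-unique : ∀ x → cotree x ≡ true → born (face (opp x)) < born (face x) → x ≡ parent (face x)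

  startᶜ : GrowingCotree 0
  startᶜ = record
    { reached = λ f → ⌊ f ≟F root ⌋
    ; cotree = λ _ → false
    ; born = λ _ → 0
    ; parent = λ _ → proj₁ (covered zero)
    ; reached-count = Faces.count-single root
    ; cotree-count = Darts.count-none
    ; root-reached = ⌊⌋-true (root ≟F root) refl
    ; cotree-reached = λ _ ()
    ; cotree-opp = λ _ → refl
    ; cotree-∉tree = λ _ ()
    ; born-≤ = λ _ _ → z≤n
    ; born-≢ = λ _ ()
    ; parent-unique = λ _ ()
    }

  module Extendᶜ {m} (C : GrowingCotree m) (x : Dart) (x∉tree : tree x ≡ false)
                 (f∈ : GrowingCotree.reached C (face x) ≡ true) (g∉ : GrowingCotree.reached C (face (opp x)) ≡ false) where
    open GrowingCotree C

    f g : Fin F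
    f = face x
    g = face (opp x)

    reached≢g : ∀ {h} → reached h ≡ true → h ≢ g
    reached≢g h∈ refl = true≢false (trans (sym h∈) g∉)

    x∉cotree : cotree x ≡ false
    x∉cotree with cotree x in x∈
    ... | false = refl
    ... | true = contradiction refl (reached≢g (proj₂ (cotree-reached x x∈)))

    opp-x∉cotree : cotree (opp x) ≡ false
    opp-x∉cotree = trans (cotree-opp x) x∉cotree

    reached′ : Fin F → Bool
    reached′ = Faces.insert reached g

    cotree′ : Dart → Bool
    cotree′ = addEdge cotree x

    born′ : Fin F → ℕ
    born′ = updateAt born g (λ _ → suc m)

    parent′ : Fin F → Dart
    parent′ = updateAt parent g (λ _ → opp x)

    born′-reached : ∀ {h} → reached h ≡ true → born′ h ≡ born h
    born′-reached {h} h∈ = updateAt-minimal h g born (reached≢g h∈)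

    parent′-reached : ∀ {h} → reached h ≡ true → parent′ h ≡ parent h
    parent′-reached {h} h∈ = updateAt-minimal h g parent (reached≢g h∈)

    opp-opp-x∈f : face (opp (opp x)) ≡ f
    opp-opp-x∈f = cong face (opp-invol x)

    born-f<born′-g : born′ f < born′ g
    born-f<born′-g = subst₂ _<_ (sym (born′-reached f∈)) (sym (updateAt-updates g born)) (s≤s (born-≤ f f∈))

    cotree′-reached : ∀ y → cotree′ y ≡ true → reached′ (face y) ≡ true × reached′ (face (opp y)) ≡ true
    cotree′-reached y y∈ with addEdge-cases cotree x y∈
    ... | inj₁ y∈cotree = Faces.insert-old reached g (proj₁ (cotree-reached y y∈cotree)) ,
                          Faces.insert-old reached g (proj₂ (cotree-reached y y∈cotree))
    ... | inj₂ (inj₁ refl) = Faces.insert-old reached g f∈ , Faces.insert-new reached g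
    ... | inj₂ (inj₂ refl) = Faces.insert-new reached g ,
                             subst (λ h → reached′ h ≡ true) (sym opp-opp-x∈f) (Faces.insert-old reached g f∈)

    cotree′-∉tree : ∀ y → cotree′ y ≡ true → tree y ≡ false
    cotree′-∉tree y y∈ with addEdge-cases cotree x y∈
    ... | inj₁ y∈cotree = cotree-∉tree y y∈cotree
    ... | inj₂ (inj₁ refl) = x∉tree
    ... | inj₂ (inj₂ refl) = trans (tree-opp x) x∉tree

    born′-≤ : ∀ h → reached′ h ≡ true → born′ h ≤ suc m
    born′-≤ h h∈ with Faces.insert-cases reached g h∈
    ... | inj₁ h∈old = subst (_≤ suc m) (sym (born′-reached h∈old)) (m≤n⇒m≤1+n (born-≤ h h∈old))
    ... | inj₂ refl = ≤-reflexive (updateAt-updates g born)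

    born′-≢ : ∀ y → cotree′ y ≡ true → born′ (face y) ≢ born′ (face (opp y))
    born′-≢ y y∈ with addEdge-cases cotree x y∈
    ... | inj₁ y∈cotree = λ eq → born-≢ y y∈cotree (trans (sym (born′-reached (proj₁ ends)))
                                                      (trans eq (born′-reached (proj₂ ends))))
      where ends = cotree-reached y y∈cotree
    ... | inj₂ (inj₁ refl) = <⇒≢ born-f<born′-g
    ... | inj₂ (inj₂ refl) = λ eq → <⇒≢ born-f<born′-g (sym (trans eq (cong born′ opp-opp-x∈f)))

    parent′-unique : ∀ y → cotree′ y ≡ true → born′ (face (opp y)) < born′ (face y) → y ≡ parent′ (face y)
    parent′-unique y y∈ lt with addEdge-cases cotree x y∈
    ... | inj₁ y∈cotree = trans (parent-unique y y∈cotree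
                            (subst₂ _<_ (born′-reached (proj₂ ends)) (born′-reached (proj₁ ends)) lt))
                            (sym (parent′-reached (proj₁ ends)))
      where ends = cotree-reached y y∈cotree
    ... | inj₂ (inj₁ refl) = contradiction (<-trans lt born-f<born′-g) (<-irrefl refl)
    ... | inj₂ (inj₂ refl) = sym (updateAt-updates g parent)

    extended : GrowingCotree (suc m)
    extended = record
      { reached = reached′
      ; cotree = cotree′
      ; born = born′
      ; parent = parent′
      ; reached-count = trans (Faces.count-insert reached g g∉) (cong suc reached-count)
      ; cotree-count = trans (addEdge-count cotree x x∉cotree opp-x∉cotree) (cong (2 +_) cotree-count)
      ; root-reached = Faces.insert-old reached g root-reached
      ; cotree-reached = cotree′-reached
      ; cotree-opp = addEdge-opp cotree x cotree-opp
      ; cotree-∉tree = cotree′-∉tree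
      ; born-≤ = born′-≤
      ; born-≢ = born′-≢
      ; parent-unique = parent′-unique
      }

  module _ {m} (C : GrowingCotree m) where
    open GrowingCotree C

    extendᶜ : suc m < F → GrowingCotree (suc m)
    extendᶜ m<F with Faces.count<size⇒∃false reached (subst (_< F) (sym reached-count) m<F)
    ... | h , h∉ with Star-leaves reached root-reached h∉ (cotree-connected root h)
    ...   | _ , _ , (x , refl , refl , x∉tree) , f∈ , g∉ = Extendᶜ.extended C x x∉tree f∈ g∉

  F-pred : ∃ λ m → F ≡ suc m
  F-pred = nonempty root
    where
    nonempty : ∀ {k} → Fin k → ∃ λ m → k ≡ suc m
    nonempty {suc m} _ = m , refl

  m : ℕ
  m = proj₁ F-pred

  F≡1+m : F ≡ suc m
  F≡1+m = proj₂ F-pred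

  growᶜ : ∀ k → k ≤ m → GrowingCotree k
  growᶜ zero _ = startᶜ
  growᶜ (suc k) k<m = extendᶜ (growᶜ k (<⇒≤ k<m)) (subst (suc (suc k) ≤_) (sym F≡1+m) (s≤s k<m))

  open GrowingCotree (growᶜ m ≤-refl)

  born-≤m : ∀ f → born f ≤ m
  born-≤m f = born-≤ f (Faces.count≡size⇒all reached (trans reached-count (sym F≡1+m)) f)

  tree-or-cotree : ∀ x → tree x ∨ cotree x ≡ true
  tree-or-cotree = Darts.count≡size⇒all (λ x → tree x ∨ cotree x) (begin
    countᴰ (λ x → tree x ∨ cotree x)  ≡⟨ Darts.count-∨ tree cotree tree⇒∉cotree ⟩
    countᴰ tree + countᴰ cotree       ≡⟨ cong₂ _+_ tree-count cotree-count ⟩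
    n * 2 + m * 2                     ≡⟨ euler-edges n m (subst (λ k → 2 * suc n + 2 * k ≡ 3 * k + 4) F≡1+m euler) ⟩
    suc m * 3                         ≡⟨ cong (_* 3) (sym F≡1+m) ⟩
    F * 3                             ∎)
    where
    open ≡-Reasoning
    tree⇒∉cotree : ∀ x → tree x ≡ true → cotree x ≡ false
    tree⇒∉cotree x x∈ with cotree x in x∈ᶜ
    ... | false = refl
    ... | true = contradiction (trans (sym x∈) (cotree-∉tree x x∈ᶜ)) true≢false

  discrepancy : Dart → Bool
  discrepancy x = a x xor agree T spin x

  discrepancy-opp : ∀ x → discrepancy (opp x) ≡ discrepancy x
  discrepancy-opp x = cong₂ _xor_ (a-opp x) (agree-opp spin x)

  discrepancy-even : ∀ f → parity (λ i → discrepancy (f , i)) ≡ false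
  discrepancy-even f = trans (parity-xor (λ i → a (f , i)) (λ i → agree T spin (f , i)))
                             (cong₂ _xor_ (a-odd f) (agree-odd spin f))

  discrepancy-tree : ∀ {x} → tree x ≡ true → discrepancy x ≡ false
  discrepancy-tree {x} x∈ = trans (cong (a x xor_) (tree-agree x x∈)) (xor-same (a x))

  -- Induction from the leaves of the dual spanning tree: by parity, the side of a face towards its
  -- parent is settled once the sides towards its children are.
  towards-parent : ∀ t {x} → cotree x ≡ true → born (face (opp x)) < born (face x) → m ≤ born (face x) + t →
    discrepancy x ≡ false
  towards-parent t {x} x∈ down bound =
    even⇒false (λ i → discrepancy (face x , i)) (slot x) (discrepancy-even (face x))
      (sibling (next3 (slot x)) (next3≢ (slot x))) (sibling (prev3 (slot x)) (prev3≢ (slot x)))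
    where
    towards-child : ∀ s {y} → face y ≡ face x → cotree y ≡ true → born (face x) < born (face (opp y)) →
      m ≤ born (face x) + s → discrepancy y ≡ false
    towards-child zero {y} _ _ up bound =
      contradiction (≤-trans (born-≤m (face (opp y))) (≤-trans bound (≤-reflexive (+-identityʳ _)))) (<⇒≱ up)
    towards-child (suc s) {y} y∈x y∈ up bound = trans (sym (discrepancy-opp y))
      (towards-parent s (trans (cotree-opp y) y∈) (subst (λ h → born h < born (face (opp y))) (sym oy∈x) up)
        (≤-trans bound (≤-trans (≤-reflexive (+-suc (born (face x)) s)) (+-monoˡ-≤ s up))))
      where
      oy∈x : face (opp (opp y)) ≡ face x
      oy∈x = trans (cong face (opp-invol y)) y∈x

    sibling : ∀ j → j ≢ slot x → discrepancy (face x , j) ≡ false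
    sibling j j≢ with ∨-true⇒ (tree-or-cotree (face x , j))
    ... | inj₁ y∈tree = discrepancy-tree y∈tree
    ... | inj₂ y∈ with <-cmp (born (face (opp (face x , j)))) (born (face x))
    ...   | tri< lt _ _ = contradiction (cong slot (trans (parent-unique _ y∈ lt) (sym (parent-unique x x∈ down)))) j≢
    ...   | tri≈ _ eq _ = contradiction (sym eq) (born-≢ _ y∈)
    ...   | tri> _ _ gt = towards-child t refl y∈ gt bound

  discrepancy-false : ∀ x → discrepancy x ≡ false
  discrepancy-false x with ∨-true⇒ (tree-or-cotree x)
  ... | inj₁ x∈tree = discrepancy-tree x∈tree
  ... | inj₂ x∈ with <-cmp (born (face (opp x))) (born (face x))
  ...   | tri< lt _ _ = towards-parent m x∈ lt (m≤n+m m _)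
  ...   | tri≈ _ eq _ = contradiction (sym eq) (born-≢ x x∈)
  ...   | tri> _ _ gt = trans (sym (discrepancy-opp x)) (towards-parent m (trans (cotree-opp x) x∈)
                          (subst (λ h → born h < born (face (opp x))) (sym (cong face (opp-invol x))) gt) (m≤n+m m _))

  realised : ∃ λ X → X zero ≡ Sign.+ × ∀ d → agree T X d ≡ a d
  realised = spin , root-spin , λ d → sym (xor≡false⇒≡ (discrepancy-false d))

M-surjective : ∀ {n} (T : Triangulation (suc n)) (S : EdgeSet T) → IsPerfectMatching T S →
  ∃ λ X → X zero ≡ Sign.+ × ∀ u v → S u v ≡ M T X u v
M-surjective T S pm = matched-by (Realisation.realised T across across-opp across-odd)
  where
  open Triangulation T
  open ExpandedDual T
  open PerfectMatching pm

  matched-by : (∃ λ X → X zero ≡ Sign.+ × ∀ d → agree T X d ≡ across d) →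
    ∃ λ X → X zero ≡ Sign.+ × ∀ u v → S u v ≡ M T X u v
  matched-by (X , X₀ , agrees) = X , X₀ , λ u v →
    bool-ext (matching-determined-by-intercity pm (M-perfect X) same-intercity u v)
             (matching-determined-by-intercity (M-perfect X) pm (sym ∘ same-intercity) u v)
    where
    same-intercity : ∀ u → S u (opp u) ≡ M T X u (opp u)
    same-intercity u = trans (sym (agrees u)) (sym (M-opp X u))

open import Data.Sign using (+)

lemma1 : ∀ {n} (T : Triangulation (suc n)) →
    ((X : Fin (suc n) → Sign) → X zero ≡ + → IsPerfectMatching T (M T X))
    × ((X Y : Fin (suc n) → Sign) → X zero ≡ + → Y zero ≡ + →
        (∀ u v → M T X u v ≡ M T Y u v) → ∀ w → X w ≡ Y w)
    × ((S : EdgeSet T) → IsPerfectMatching T S →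
        Σ (Fin (suc n) → Sign) λ X → X zero ≡ + × (∀ u v → S u v ≡ M T X u v))
lemma1 T = (λ X _ → ExpandedDual.M-perfect T X)
         , (λ X Y X₀ Y₀ → ExpandedDual.M-injective T X Y zero (trans X₀ (sym Y₀)))
         , M-surjective T
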